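{- For $m\ge1$ define polynomials by $p_1(x)=x$, $q_1(x)=1$, and for $m>1$, $p_m(x)=p_{m-1}(x)q_{m-1}(x)$ and $q_m(x)=q_{m-1}(x)^2-\frac{p_{m-1}(x)^2}{x}$. For $m\ge1$ let $A_m$ be the $m\times m$ coloring matrix with entries $a_{ij}=1$ if $i>j$ and $a_{ij}=0$ if $i\le j$. Then for every $m\ge1$, the generating function $F^{(m)}(x)=\sum_{n\ge1}t_{A_m}^{(m)}(n)x^n$ is rational, and $$F^{(m)}(x)=\frac{p_m(x)}{q_m(x)}.$$
   Context: A plane tree is an unlabeled rooted tree in which the children of every vertex are linearly ordered. A coloring matrix is an $m\times m$ matrix $A=(a_{ij})$ with entries in $\{0,1\}$. An $A$-coloring of a plane tree assigns to each vertex a color in $\{1,\dots,m\}$ such that whenever a vertex of color $j$ is a child of a vertex of color $i$, $a_{ij}=1$. Let $t_A^{(i)}(n)$ be the number of pairs (plane tree with $n$ vertices, $A$-coloring of it) in which the root has color $i$. -}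

module Defs where

open import Data.Bool.Base using (if_then_else_)
open import Data.Empty using (⊥-elim)
open import Data.Fin.Base using (Fin; fromℕ)
open import Data.Fin.Patterns using (0F; 1F)
open import Data.Fin.Properties using (1↔⊤; +↔⊎; *↔×; _<?_) renaming (_≟_ to _≟ᶠ_)
open import Data.Integer.Base using (+_)
open import Data.List.Base using (List; []; _∷_; map; drop)
open import Data.List.Relation.Unary.All using (All; []; _∷_)
open import Data.Nat.Base as ℕ using (ℕ; zero; suc; NonZero; s≤s)
import Data.Nat.Properties as ℕ
open import Data.Product.Base using (Σ; _×_; _,_; proj₁)
open import Data.Product.Function.NonDependent.Propositional using (_×-↔_)
open import Data.Rational.Base as ℚ using (ℚ; 0ℚ; 1ℚ)
import Data.Rational.Properties as ℚ
open import Data.Sum.Base using (_⊎_; inj₁; inj₂)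
open import Data.Sum.Function.Propositional using (_⊎-↔_)
open import Data.Unit.Base using (⊤; tt)
open import Function.Bundles using (_↔_; mk↔ₛ′)
open import Function.Construct.Composition using (_↔-∘_)
open import Function.Construct.Symmetry using (↔-sym)
open import Relation.Binary.PropositionalEquality
open import Relation.Nullary using (¬_; yes; no; does)

data PlaneTree : Set where
  node : List PlaneTree → PlaneTree

mutual
  vertices : PlaneTree → ℕ
  vertices (node ts) = suc (vertices* ts)

  vertices* : List PlaneTree → ℕ
  vertices* []       = 0
  vertices* (t ∷ ts) = vertices t ℕ.+ vertices* ts

ColoringMatrix : ℕ → Set
ColoringMatrix m = Fin m → Fin m → Fin 2

-- An assignment of an arbitrary color to each vertex of a tree. It is inductive
-- rather than a function on vertices, so that _≡_ is the right equality.
data Coloring (m : ℕ) : PlaneTree → Set where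
  node : ∀ {ts} → Fin m → All (Coloring m) ts → Coloring m (node ts)

rootColor : ∀ {m t} → Coloring m t → Fin m
rootColor (node i _) = i

mutual
  IsColoring : ∀ {m} → ColoringMatrix m → ∀ {t} → Coloring m t → Set
  IsColoring A (node i cs) = IsColoring* A i cs

  IsColoring* : ∀ {m} → ColoringMatrix m → Fin m → ∀ {ts} → All (Coloring m) ts → Set
  IsColoring* A i []       = ⊤
  IsColoring* A i (c ∷ cs) = A i (rootColor c) ≡ 1F × IsColoring A c × IsColoring* A i cs

record ColoredTree {m : ℕ} (A : ColoringMatrix m) (i : Fin m) (n : ℕ) : Set where
  constructor coloredTree
  field
    tree       : PlaneTree
    coloring   : Coloring m tree
    n-vertices : vertices tree ≡ n
    isColoring : IsColoring A coloring
    root       : rootColor coloring ≡ i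

Finite : Set → Set
Finite X = Σ ℕ λ k → X ↔ Fin k

transport : ∀ {X Y} → X ↔ Y → Finite Y → Finite X
transport f (k , g) = k , (g ↔-∘ f)

finite-⊥ : ∀ {X : Set} → ¬ X → Finite X
finite-⊥ ¬x = 0 , mk↔ₛ′ (λ x → ⊥-elim (¬x x)) (λ ()) (λ ()) (λ x → ⊥-elim (¬x x))

finite-⊤ : ∀ {X : Set} (x : X) → (∀ y → x ≡ y) → Finite X
finite-⊤ x h = transport (mk↔ₛ′ (λ _ → tt) (λ _ → x) (λ _ → refl) h) (1 , ↔-sym 1↔⊤)

finite-⊎ : ∀ {X Y} → Finite X → Finite Y → Finite (X ⊎ Y)
finite-⊎ (a , f) (b , g) = a ℕ.+ b , (↔-sym +↔⊎ ↔-∘ (f ⊎-↔ g))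

finite-× : ∀ {X Y} → Finite X → Finite Y → Finite (X × Y)
finite-× (a , f) (b , g) = a ℕ.* b , (↔-sym *↔× ↔-∘ (f ×-↔ g))

finite-Σ : ∀ {m} {P : Fin m → Set} → (∀ j → Finite (P j)) → Finite (Σ (Fin m) P)
finite-Σ {zero}      h = finite-⊥ λ { (() , _) }
finite-Σ {suc m} {P} h = transport
  (mk↔ₛ′ to from
    (λ { (inj₁ _) → refl ; (inj₂ _) → refl })
    (λ { (Fin.zero , _) → refl ; (Fin.suc _ , _) → refl }))
  (finite-⊎ (h Fin.zero) (finite-Σ (λ j → h (Fin.suc j))))
  where
  to : Σ (Fin (suc m)) P → P Fin.zero ⊎ Σ (Fin m) (λ j → P (Fin.suc j))
  to (Fin.zero , x)  = inj₁ x
  to (Fin.suc j , x) = inj₂ (j , x)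
  from : P Fin.zero ⊎ Σ (Fin m) (λ j → P (Fin.suc j)) → Σ (Fin (suc m)) P
  from (inj₁ x)       = Fin.zero , x
  from (inj₂ (j , x)) = Fin.suc j , x

finite-≡ : ∀ {m} (i j : Fin m) → Finite (i ≡ j)
finite-≡ i j with i ≟ᶠ j
... | yes refl = finite-⊤ refl λ { refl → refl }
... | no  i≢j  = finite-⊥ i≢j

Split : ℕ → (ℕ → ℕ → Set) → Set
Split n P = Σ ℕ λ k → Σ ℕ λ l → k ℕ.+ l ≡ n × P k l

finite-Split : ∀ n {P : ℕ → ℕ → Set} →
               (∀ k l → k ℕ.+ l ≡ n → Finite (P k l)) → Finite (Split n P)
finite-Split zero {P} h = transport
  (mk↔ₛ′ to (λ x → 0 , 0 , refl , x) (λ _ → refl) (λ { (0 , 0 , refl , x) → refl }))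
  (h 0 0 refl)
  where
  to : Split 0 P → P 0 0
  to (0 , 0 , refl , x) = x
finite-Split (suc n) {P} h = transport
  (mk↔ₛ′ to from
    (λ { (inj₁ _) → refl ; (inj₂ (_ , _ , refl , _)) → refl })
    (λ { (0 , _ , refl , _) → refl ; (suc _ , _ , refl , _) → refl }))
  (finite-⊎ (h 0 (suc n) refl)
            (finite-Split n (λ k l eq → h (suc k) l (cong suc eq))))
  where
  to : Split (suc n) P → P 0 (suc n) ⊎ Split n (λ k → P (suc k))
  to (0     , l , refl , x) = inj₁ x
  to (suc k , l , refl , x) = inj₂ (k , l , refl , x)
  from : P 0 (suc n) ⊎ Split n (λ k → P (suc k)) → Split (suc n) P
  from (inj₁ x)                  = 0 , suc n , refl , x
  from (inj₂ (k , l , refl , x)) = suc k , l , refl , x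

module _ {m : ℕ} (A : ColoringMatrix m) where

  -- The possible lists of subtrees below a vertex of color i.
  record ColoredForest (i : Fin m) (n : ℕ) : Set where
    constructor coloredForest
    field
      trees      : List PlaneTree
      colorings  : All (Coloring m) trees
      n-vertices : vertices* trees ≡ n
      isColoring : IsColoring* A i colorings

  tree↔forest : ∀ i n → ColoredTree A i (suc n) ↔ ColoredForest i n
  tree↔forest i n = mk↔ₛ′ to from
    (λ { (coloredForest _ _ refl _) → refl })
    (λ { (coloredTree (node _) (node _ _) refl _ refl) → refl })
    where
    to : ColoredTree A i (suc n) → ColoredForest i n
    to (coloredTree (node ts) (node _ cs) refl v refl) = coloredForest ts cs refl v
    from : ColoredForest i n → ColoredTree A i (suc n)
    from (coloredForest ts cs refl v) = coloredTree (node ts) (node i cs) refl v refl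

  First : Fin m → ℕ → ℕ → Set
  First i k l = Σ (Fin m) λ j → A i j ≡ 1F × ColoredForest j k × ColoredForest i l

  forest↔split : ∀ i n → ColoredForest i (suc n) ↔ Split n (First i)
  forest↔split i n = mk↔ₛ′ to from
    (λ { (_ , _ , refl , j , a , coloredForest _ _ refl _ , coloredForest _ _ refl _) → refl })
    (λ { (coloredForest (node _ ∷ _) (node _ _ ∷ _) refl _) → refl })
    where
    to : ColoredForest i (suc n) → Split n (First i)
    to (coloredForest (node us ∷ ts) (node j ds ∷ cs) refl (a , w , v)) =
      _ , _ , refl , j , a , coloredForest us ds refl w , coloredForest ts cs refl v
    from : Split n (First i) → ColoredForest i (suc n)
    from (_ , _ , refl , j , a , coloredForest us ds refl w , coloredForest ts cs refl v) =
      coloredForest (node us ∷ ts) (node j ds ∷ cs) refl (a , w , v)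

  finite-forest : ∀ N n → n ℕ.< N → ∀ i → Finite (ColoredForest i n)
  finite-forest (suc N) zero    _         i = finite-⊤ (coloredForest [] [] refl tt)
    λ { (coloredForest [] [] refl tt) → refl ; (coloredForest (node _ ∷ _) _ () _) }
  finite-forest (suc N) (suc n) (s≤s n<N) i = transport (forest↔split i n)
    (finite-Split n λ k l k+l≡n → finite-Σ λ j → finite-× (finite-≡ (A i j) 1F) (finite-×
      (finite-forest N k (ℕ.≤-<-trans (subst (k ℕ.≤_) k+l≡n (ℕ.m≤m+n k l)) n<N) j)
      (finite-forest N l (ℕ.≤-<-trans (subst (l ℕ.≤_) k+l≡n (ℕ.m≤n+m l k)) n<N) i)))

  finite-tree : ∀ i n → Finite (ColoredTree A i n)
  finite-tree i zero    = finite-⊥ λ { (coloredTree (node _) _ () _ _) }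
  finite-tree i (suc n) = transport (tree↔forest i n) (finite-forest (suc n) n ℕ.≤-refl i)

  t : Fin m → ℕ → ℕ
  t i n = proj₁ (finite-tree i n)

-- Coefficient lists, constant term first; trailing zeros are allowed.
Polynomial : Set
Polynomial = List ℚ

infixl 6 _⊕_ _⊖_
infixl 7 _⊗_

_⊕_ : Polynomial → Polynomial → Polynomial
[]      ⊕ Q       = Q
(a ∷ P) ⊕ []      = a ∷ P
(a ∷ P) ⊕ (b ∷ Q) = (a ℚ.+ b) ∷ (P ⊕ Q)

_⊖_ : Polynomial → Polynomial → Polynomial
P ⊖ Q = P ⊕ map ℚ.-_ Q

_⊗_ : Polynomial → Polynomial → Polynomial
[]      ⊗ Q = []
(a ∷ P) ⊗ Q = map (a ℚ.*_) Q ⊕ (0ℚ ∷ (P ⊗ Q))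

X : Polynomial
X = 0ℚ ∷ 1ℚ ∷ []

-- Division by x with the constant term discarded; exact where it is used below,
-- see p²/x-exact.
_/x : Polynomial → Polynomial
P /x = drop 1 P

Series : Set
Series = ℕ → ℚ

infix 4 _≈_
_≈_ : Series → Series → Set
f ≈ g = ∀ n → f n ≡ g n

sumUpTo : ℕ → (ℕ → ℚ) → ℚ
sumUpTo zero    h = h 0
sumUpTo (suc n) h = h 0 ℚ.+ sumUpTo n (λ k → h (suc k))

infixl 7 _⊛_
_⊛_ : Series → Series → Series
(f ⊛ g) n = sumUpTo n λ k → f k ℚ.* g (n ℕ.∸ k)

1ˢ : Series
1ˢ zero    = 1ℚ
1ˢ (suc _) = 0ℚ

⟦_⟧ : Polynomial → Series
⟦ []    ⟧ _       = 0ℚ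
⟦ a ∷ P ⟧ zero    = a
⟦ a ∷ P ⟧ (suc n) = ⟦ P ⟧ n

-- F = P / Q in ℚ[[x]]: Q is a unit there, and F = P Q⁻¹.
infix 4 _≈_÷_
_≈_÷_ : Series → Polynomial → Polynomial → Set
F ≈ P ÷ Q = Σ Series λ Q⁻¹ → ⟦ Q ⟧ ⊛ Q⁻¹ ≈ 1ˢ × F ≈ ⟦ P ⟧ ⊛ Q⁻¹

Rational : Series → Set
Rational F = Σ Polynomial λ P → Σ Polynomial λ Q → F ≈ P ÷ Q

-- ∑_{n ≥ 1} f(n) xⁿ
generatingFunction : (ℕ → ℕ) → Series
generatingFunction f zero    = 0ℚ
generatingFunction f (suc n) = + f (suc n) ℚ./ 1

mutual
  p : (m : ℕ) .{{_ : NonZero m}} → Polynomial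
  p 1             = X
  p (suc (suc m)) = p (suc m) ⊗ q (suc m)

  q : (m : ℕ) .{{_ : NonZero m}} → Polynomial
  q 1             = 1ℚ ∷ []
  q (suc (suc m)) = q (suc m) ⊗ q (suc m) ⊖ (p (suc m) ⊗ p (suc m)) /x

A : (m : ℕ) → ColoringMatrix m
A m i j = if does (j <? i) then 1F else 0F

-- Color m; colors 1,…,m are represented by 0,…,m-1.
lastColor : (m : ℕ) .{{_ : NonZero m}} → Fin m
lastColor (suc k) = fromℕ k

F : (m : ℕ) .{{_ : NonZero m}} → Series
F m = generatingFunction (t (A m) (lastColor m))

⊕-coeff : ∀ P Q n → ⟦ P ⊕ Q ⟧ n ≡ ⟦ P ⟧ n ℚ.+ ⟦ Q ⟧ n
⊕-coeff []      Q       n       = sym (ℚ.+-identityˡ _)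
⊕-coeff (a ∷ P) []      n       = sym (ℚ.+-identityʳ _)
⊕-coeff (a ∷ P) (b ∷ Q) zero    = refl
⊕-coeff (a ∷ P) (b ∷ Q) (suc n) = ⊕-coeff P Q n

scale-coeff : ∀ a P n → ⟦ map (a ℚ.*_) P ⟧ n ≡ a ℚ.* ⟦ P ⟧ n
scale-coeff a []      n       = sym (ℚ.*-zeroʳ a)
scale-coeff a (b ∷ P) zero    = refl
scale-coeff a (b ∷ P) (suc n) = scale-coeff a P n

⊗-constant : ∀ P Q → ⟦ P ⟧ 0 ≡ 0ℚ → ⟦ P ⊗ Q ⟧ 0 ≡ 0ℚ
⊗-constant []      Q _ = refl
⊗-constant (a ∷ P) Q h = begin
  ⟦ map (a ℚ.*_) Q ⊕ (0ℚ ∷ (P ⊗ Q)) ⟧ 0 ≡⟨ ⊕-coeff (map (a ℚ.*_) Q) _ 0 ⟩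
  ⟦ map (a ℚ.*_) Q ⟧ 0 ℚ.+ 0ℚ           ≡⟨ ℚ.+-identityʳ _ ⟩
  ⟦ map (a ℚ.*_) Q ⟧ 0                  ≡⟨ scale-coeff a Q 0 ⟩
  a ℚ.* ⟦ Q ⟧ 0                         ≡⟨ cong (ℚ._* ⟦ Q ⟧ 0) h ⟩
  0ℚ ℚ.* ⟦ Q ⟧ 0                        ≡⟨ ℚ.*-zeroˡ (⟦ Q ⟧ 0) ⟩
  0ℚ                                    ∎
  where open ≡-Reasoning

p-constant : ∀ m .{{_ : NonZero m}} → ⟦ p m ⟧ 0 ≡ 0ℚ
p-constant 1             = refl
p-constant (suc (suc m)) = ⊗-constant (p (suc m)) (q (suc m)) (p-constant (suc m))

X⊗-zero : ∀ P → ⟦ X ⊗ P ⟧ 0 ≡ 0ℚ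
X⊗-zero P = ⊗-constant X P refl

X⊗-suc : ∀ P n → ⟦ X ⊗ P ⟧ (suc n) ≡ ⟦ P ⟧ n
X⊗-suc P n = begin
  ⟦ X ⊗ P ⟧ (suc n)
    ≡⟨ ⊕-coeff (map (0ℚ ℚ.*_) P) _ (suc n) ⟩
  ⟦ map (0ℚ ℚ.*_) P ⟧ (suc n) ℚ.+ ⟦ map (1ℚ ℚ.*_) P ⊕ (0ℚ ∷ []) ⟧ n
    ≡⟨ cong₂ ℚ._+_ (trans (scale-coeff 0ℚ P (suc n)) (ℚ.*-zeroˡ (⟦ P ⟧ (suc n))))
                   (⊕-coeff (map (1ℚ ℚ.*_) P) (0ℚ ∷ []) n) ⟩
  0ℚ ℚ.+ (⟦ map (1ℚ ℚ.*_) P ⟧ n ℚ.+ ⟦ 0ℚ ∷ [] ⟧ n)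
    ≡⟨ ℚ.+-identityˡ _ ⟩
  ⟦ map (1ℚ ℚ.*_) P ⟧ n ℚ.+ ⟦ 0ℚ ∷ [] ⟧ n
    ≡⟨ cong₂ ℚ._+_ (trans (scale-coeff 1ℚ P n) (ℚ.*-identityˡ (⟦ P ⟧ n))) (0-coeff n) ⟩
  ⟦ P ⟧ n ℚ.+ 0ℚ
    ≡⟨ ℚ.+-identityʳ (⟦ P ⟧ n) ⟩
  ⟦ P ⟧ n ∎
  where
  open ≡-Reasoning
  0-coeff : ∀ n → ⟦ 0ℚ ∷ [] ⟧ n ≡ 0ℚ
  0-coeff zero    = refl
  0-coeff (suc n) = refl

/x-coeff : ∀ P n → ⟦ P /x ⟧ n ≡ ⟦ P ⟧ (suc n)
/x-coeff []      n = refl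
/x-coeff (a ∷ P) n = refl

p²/x-exact : ∀ m .{{_ : NonZero m}} → ⟦ X ⊗ (p m ⊗ p m) /x ⟧ ≈ ⟦ p m ⊗ p m ⟧
p²/x-exact m zero    = trans (X⊗-zero ((p m ⊗ p m) /x))
                             (sym (⊗-constant (p m) (p m) (p-constant m)))
p²/x-exact m (suc n) = trans (X⊗-suc ((p m ⊗ p m) /x) n) (/x-coeff (p m ⊗ p m) n)

{-# OPTIONS --safe #-}

-- Write T_i = x G_i for the generating function of trees whose root has the i-th
-- color, so that G_i counts the forests below such a root, and S_i = Σ_{j<i} G_j.
-- Splitting off the first tree of a forest gives G_i (1 - x S_i) = 1. As
-- S_{i+1} = S_i + G_i, this is the recursion x/T_{i+1} = x/T_i - T_i, which becomes
-- the recursion for p and q upon writing T_i = p/q. An inverse of q_{i+1} is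
-- q_i⁻² G_{i+1} (1 - x S_i), so no inversion of power series is needed.

module Submission where

open import Algebra.Bundles using (CommutativeRing)
open import Algebra.Structures using (IsCommutativeRing)
import Algebra.Construct.Pointwise as Pointwise
import Algebra.Properties.Ring as RingProperties
import Algebra.Solver.Ring.NaturalCoefficients.Default as SemiringSolver
open import Data.Bool.Base using (if_then_else_)
open import Data.Fin.Base using (Fin; zero; suc; toℕ; fromℕ; inject₁)
open import Data.Fin.Induction using (<-weakInduction)
open import Data.Fin.Patterns using (0F; 1F)
open import Data.Fin.Permutation using (↔⇒≡)
open import Data.Fin.Properties using (_<?_; toℕ-fromℕ; toℕ-inject₁)
open import Data.Integer.Base as ℤ using (+_)
import Data.Integer.Properties as ℤ
open import Data.List.Base using ([]; _∷_; map)
open import Data.Nat.Base as ℕ using (ℕ; zero; suc; NonZero)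
import Data.Nat.Properties as ℕ
open import Data.Product.Base using (_×_; _,_; proj₁)
open import Data.Rational.Base as ℚ using (ℚ; 0ℚ; 1ℚ)
import Data.Rational.Properties as ℚ
import Data.Rational.Unnormalised.Base as ℚᵘ
import Data.Rational.Unnormalised.Properties as ℚᵘ
open import Defs
open import Function.Construct.Composition using (_↔-∘_)
open import Function.Construct.Symmetry using (↔-sym)
import Relation.Binary.Reasoning.Setoid as SetoidReasoning
open import Relation.Binary.PropositionalEquality using (_≡_; refl; sym; trans; cong; cong₂; subst; module ≡-Reasoning)
open import Relation.Nullary using (does)
open import Algebra.Properties.Semiring.Sum ℕ.+-*-semiring using (sum; sum-cong-≗; *-distribʳ-sum)
open import Algebra.Properties.CommutativeSemigroup (CommutativeRing.+-commutativeSemigroup ℚ.+-*-commutativeRing) using (interchange) renaming (x∙yz≈y∙xz to +-leftComm)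

-- Formal power series

infixl 6 _+ˢ_
_+ˢ_ : Series → Series → Series
(f +ˢ g) n = f n ℚ.+ g n

-ˢ_ : Series → Series
(-ˢ f) n = ℚ.- f n

0ˢ : Series
0ˢ _ = 0ℚ

tail : Series → Series
tail f n = f (suc n)

scale : ℚ → Series → Series
scale a f n = a ℚ.* f n

-- The defining sum unfolds by computation: `(f ⊛ g) (suc n)` is
-- `f 0 ℚ.* g (suc n) ℚ.+ (tail f ⊛ g) n`. The ring laws below are inductions on `n` along this
-- unfolding.
⊛-cong : ∀ {f f′ g g′} → f ≈ f′ → g ≈ g′ → f ⊛ g ≈ f′ ⊛ g′
⊛-cong f≈f′ g≈g′ zero    = cong₂ ℚ._*_ (f≈f′ 0) (g≈g′ 0)
⊛-cong f≈f′ g≈g′ (suc n) = cong₂ ℚ._+_ (cong₂ ℚ._*_ (f≈f′ 0) (g≈g′ (suc n)))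
                                       (⊛-cong (λ k → f≈f′ (suc k)) g≈g′ n)

⊛-zeroˡ : ∀ f → 0ˢ ⊛ f ≈ 0ˢ
⊛-zeroˡ f zero    = ℚ.*-zeroˡ (f 0)
⊛-zeroˡ f (suc n) = trans (cong₂ ℚ._+_ (ℚ.*-zeroˡ (f (suc n))) (⊛-zeroˡ f n)) (ℚ.+-identityˡ 0ℚ)

⊛-identityˡ : ∀ f → 1ˢ ⊛ f ≈ f
⊛-identityˡ f zero    = ℚ.*-identityˡ (f 0)
⊛-identityˡ f (suc n) = trans (cong₂ ℚ._+_ (ℚ.*-identityˡ (f (suc n))) (⊛-zeroˡ f n)) (ℚ.+-identityʳ _)

⊛-distribʳ : ∀ h f g → (f +ˢ g) ⊛ h ≈ (f ⊛ h) +ˢ (g ⊛ h)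
⊛-distribʳ h f g zero    = ℚ.*-distribʳ-+ (h 0) (f 0) (g 0)
⊛-distribʳ h f g (suc n) = trans
  (cong₂ ℚ._+_ (ℚ.*-distribʳ-+ (h (suc n)) (f 0) (g 0)) (⊛-distribʳ h (tail f) (tail g) n))
  (interchange (f 0 ℚ.* h (suc n)) (g 0 ℚ.* h (suc n)) _ _)

scale-⊛ : ∀ a f g → scale a f ⊛ g ≈ scale a (f ⊛ g)
scale-⊛ a f g zero    = ℚ.*-assoc a (f 0) (g 0)
scale-⊛ a f g (suc n) = trans
  (cong₂ ℚ._+_ (ℚ.*-assoc a (f 0) (g (suc n))) (scale-⊛ a (tail f) g n))
  (sym (ℚ.*-distribˡ-+ a _ _))

⊛-assoc : ∀ f g h → (f ⊛ g) ⊛ h ≈ f ⊛ (g ⊛ h)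
⊛-assoc f g h zero    = ℚ.*-assoc (f 0) (g 0) (h 0)
⊛-assoc f g h (suc n) = begin
  -- The tail of `f ⊛ g` is, by computation, `scale (f 0) (tail g) +ˢ (tail f ⊛ g)`.
  f 0 ℚ.* g 0 ℚ.* h (suc n) ℚ.+ ((scale (f 0) (tail g) +ˢ (tail f ⊛ g)) ⊛ h) n
    ≡⟨ cong₂ ℚ._+_ (ℚ.*-assoc (f 0) (g 0) (h (suc n))) (⊛-distribʳ h (scale (f 0) (tail g)) (tail f ⊛ g) n) ⟩
  f 0 ℚ.* (g 0 ℚ.* h (suc n)) ℚ.+ ((scale (f 0) (tail g) ⊛ h) n ℚ.+ ((tail f ⊛ g) ⊛ h) n)
    ≡⟨ cong (f 0 ℚ.* (g 0 ℚ.* h (suc n)) ℚ.+_)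
         (cong₂ ℚ._+_ (scale-⊛ (f 0) (tail g) h n) (⊛-assoc (tail f) g h n)) ⟩
  f 0 ℚ.* (g 0 ℚ.* h (suc n)) ℚ.+ (f 0 ℚ.* (tail g ⊛ h) n ℚ.+ (tail f ⊛ (g ⊛ h)) n)
    ≡⟨ ℚ.+-assoc (f 0 ℚ.* (g 0 ℚ.* h (suc n))) _ _ ⟨
  f 0 ℚ.* (g 0 ℚ.* h (suc n)) ℚ.+ f 0 ℚ.* (tail g ⊛ h) n ℚ.+ (tail f ⊛ (g ⊛ h)) n
    ≡⟨ cong (ℚ._+ (tail f ⊛ (g ⊛ h)) n) (ℚ.*-distribˡ-+ (f 0) _ _) ⟨
  f 0 ℚ.* (g ⊛ h) (suc n) ℚ.+ (tail f ⊛ (g ⊛ h)) n ∎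
  where open ≡-Reasoning

-- Convolution unfolds on its left factor only; peeling the right one is what lets commutativity go
-- by induction.
⊛-tailʳ : ∀ f g n → (f ⊛ g) (suc n) ≡ g 0 ℚ.* f (suc n) ℚ.+ (f ⊛ tail g) n
⊛-tailʳ f g zero    = trans (ℚ.+-comm (f 0 ℚ.* g 1) _) (cong (ℚ._+ f 0 ℚ.* g 1) (ℚ.*-comm (f 1) (g 0)))
⊛-tailʳ f g (suc n) = trans
  (cong (f 0 ℚ.* g (suc (suc n)) ℚ.+_) (⊛-tailʳ (tail f) g n))
  (+-leftComm (f 0 ℚ.* g (suc (suc n))) (g 0 ℚ.* f (suc (suc n))) ((tail f ⊛ tail g) n))

⊛-comm : ∀ f g → f ⊛ g ≈ g ⊛ f
⊛-comm f g zero    = ℚ.*-comm (f 0) (g 0)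
⊛-comm f g (suc n) = trans (cong (f 0 ℚ.* g (suc n) ℚ.+_) (⊛-comm (tail f) g n))
                           (sym (⊛-tailʳ g f n))

⊛-isCommutativeRing : IsCommutativeRing _≈_ _+ˢ_ _⊛_ -ˢ_ 0ˢ 1ˢ
⊛-isCommutativeRing = record
  { isRing = record
    { +-isAbelianGroup = Pointwise.isAbelianGroup ℕ ℚ.+-0-isAbelianGroup
    ; *-cong           = ⊛-cong
    ; *-assoc          = ⊛-assoc
    ; *-identity       = ⊛-identityˡ , λ f n → trans (⊛-comm f 1ˢ n) (⊛-identityˡ f n)
    ; distrib          = (λ f g h n → trans (⊛-comm f (g +ˢ h) n) (trans (⊛-distribʳ f g h n)
                           (cong₂ ℚ._+_ (⊛-comm g f n) (⊛-comm h f n))))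
                       , ⊛-distribʳ
    }
  ; *-comm = ⊛-comm
  }

seriesRing : CommutativeRing _ _
seriesRing = record { isCommutativeRing = ⊛-isCommutativeRing }

module S = CommutativeRing seriesRing
open S using () renaming (refl to ≈-refl; sym to ≈-sym; trans to ≈-trans; setoid to ≈-setoid)

-- Polynomials as power series

⟦1⟧ : ⟦ 1ℚ ∷ [] ⟧ ≈ 1ˢ
⟦1⟧ zero    = refl
⟦1⟧ (suc n) = refl

⟦⊗⟧ : ∀ P Q → ⟦ P ⊗ Q ⟧ ≈ ⟦ P ⟧ ⊛ ⟦ Q ⟧
⟦⊗⟧ []      Q n       = sym (⊛-zeroˡ ⟦ Q ⟧ n)
⟦⊗⟧ (a ∷ P) Q zero    = trans (⊕-coeff (map (a ℚ.*_) Q) _ 0)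
                          (trans (ℚ.+-identityʳ _) (scale-coeff a Q 0))
⟦⊗⟧ (a ∷ P) Q (suc n) = trans (⊕-coeff (map (a ℚ.*_) Q) _ (suc n))
                          (cong₂ ℚ._+_ (scale-coeff a Q (suc n)) (⟦⊗⟧ P Q n))

⟦neg⟧ : ∀ P → ⟦ map ℚ.-_ P ⟧ ≈ -ˢ ⟦ P ⟧
⟦neg⟧ []      n       = refl
⟦neg⟧ (a ∷ P) zero    = refl
⟦neg⟧ (a ∷ P) (suc n) = ⟦neg⟧ P n

⟦⊖⟧ : ∀ P Q → ⟦ P ⊖ Q ⟧ ≈ ⟦ P ⟧ +ˢ (-ˢ ⟦ Q ⟧)
⟦⊖⟧ P Q n = trans (⊕-coeff P (map ℚ.-_ Q) n) (cong (⟦ P ⟧ n ℚ.+_) (⟦neg⟧ Q n))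

x : Series
x = ⟦ X ⟧

x⊛-zero : ∀ f → (x ⊛ f) 0 ≡ 0ℚ
x⊛-zero f = ℚ.*-zeroˡ (f 0)

x⊛-suc : ∀ f n → (x ⊛ f) (suc n) ≡ f n
x⊛-suc f n = trans
  (cong₂ ℚ._+_ (ℚ.*-zeroˡ (f (suc n))) (trans (⊛-cong {g = f} ⟦1⟧ ≈-refl n) (⊛-identityˡ f n)))
  (ℚ.+-identityˡ (f n))

-- Dropping the constant term reads off the coefficient one place up, and there the outer factor of
-- `x ⊛ (f ⊛ (x ⊛ f))` cancels. This removes the division by x from the recursion for `q`.
⟦²/x⟧ : ∀ P f → ⟦ P ⟧ ≈ x ⊛ f → ⟦ (P ⊗ P) /x ⟧ ≈ f ⊛ (x ⊛ f)
⟦²/x⟧ P f P≈xf n = begin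
  ⟦ (P ⊗ P) /x ⟧ n            ≡⟨ /x-coeff (P ⊗ P) n ⟩
  ⟦ P ⊗ P ⟧ (suc n)           ≡⟨ ⟦⊗⟧ P P (suc n) ⟩
  (⟦ P ⟧ ⊛ ⟦ P ⟧) (suc n)     ≡⟨ ⊛-cong P≈xf P≈xf (suc n) ⟩
  (x ⊛ f ⊛ (x ⊛ f)) (suc n)   ≡⟨ ⊛-assoc x f (x ⊛ f) (suc n) ⟩
  (x ⊛ (f ⊛ (x ⊛ f))) (suc n) ≡⟨ x⊛-suc (f ⊛ (x ⊛ f)) n ⟩
  (f ⊛ (x ⊛ f)) n             ∎
  where open ≡-Reasoning

-- One step of the recursion, in an arbitrary commutative ring

module Step {c ℓ} (R : CommutativeRing c ℓ) where
  open CommutativeRing R renaming (_≈_ to _≋_; refl to ≋-refl; sym to ≋-sym; trans to ≋-trans)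
  open RingProperties ring
  open SemiringSolver commutativeSemiring
  open SetoidReasoning setoid

  unfold⇒inverse : ∀ x G S → G ≋ 1# + x * (S * G) → G * (1# - x * S) ≋ 1#
  unfold⇒inverse x G S G≋ = begin
    G * (1# - x * S)            ≈⟨ x[y-z]≈xy-xz G 1# (x * S) ⟩
    G * 1# - G * (x * S)        ≈⟨ +-cong (≋-trans (*-identityʳ G) G≋) (-‿cong
                                     (solve 3 (λ g y s → g :* (y :* s) := y :* (s :* g)) ≋-refl G x S)) ⟩
    1# + x * (S * G) - x * (S * G)
      ≈⟨ +-assoc 1# _ _ ⟩
    1# + (x * (S * G) - x * (S * G))
      ≈⟨ +-congˡ (-‿inverseʳ (x * (S * G))) ⟩
    1# + 0#                     ≈⟨ +-identityʳ 1# ⟩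
    1#                          ∎

  1-x[S+G]+xG : ∀ x S G → (1# - x * (S + G)) + x * G ≋ 1# - x * S
  1-x[S+G]+xG x S G = begin
    (1# - x * (S + G)) + x * G          ≈⟨ +-congʳ (+-congˡ (-‿cong (distribˡ x S G))) ⟩
    (1# - (x * S + x * G)) + x * G      ≈⟨ +-congʳ (+-congˡ (-‿+-comm (x * S) (x * G))) ⟨
    (1# + (- (x * S) - x * G)) + x * G  ≈⟨ solve 4 (λ o a b d → (o :+ (a :+ b)) :+ d := (o :+ a) :+ (b :+ d))
                                             ≋-refl 1# (- (x * S)) (- (x * G)) (x * G) ⟩
    (1# - x * S) + (- (x * G) + x * G)  ≈⟨ +-congˡ (-‿inverseˡ (x * G)) ⟩
    (1# - x * S) + 0#                   ≈⟨ +-identityʳ _ ⟩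
    1# - x * S                          ∎

  -- Primes mark the next color: `G` is the forest series, `U` is 1 - xS, `P` is p/x, `Q` is q and
  -- `V` its inverse. The relations that involve a subtraction are given as sums, so that a semiring
  -- solver suffices.
  module Recursion (x G G′ U U′ P Q Q′ V : Carrier)
    (GU≋1 : G * U ≋ 1#) (G′U′≋1 : G′ * U′ ≋ 1#) (U′+xG≋U : U′ + x * G ≋ U)
    (QV≋1 : Q * V ≋ 1#) (G≋PV : G ≋ P * V) (Q′+PxP≋Q² : Q′ + P * (x * P) ≋ Q * Q) where

    Q′V²≋GU′ : Q′ * (V * V) ≋ G * U′
    -- After adding `x * (G * G)` both sides equal 1: the left becomes the square of `Q * V`, the
    -- right becomes `G * U`.
    Q′V²≋GU′ = +-cancelʳ (x * (G * G)) _ _ (begin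
      Q′ * (V * V) + x * (G * G)              ≈⟨ +-congˡ (*-congˡ (*-cong G≋PV G≋PV)) ⟩
      Q′ * (V * V) + x * ((P * V) * (P * V))  ≈⟨ solve 4 (λ q′ v y p →
                                                   q′ :* (v :* v) :+ y :* ((p :* v) :* (p :* v))
                                                   := (q′ :+ p :* (y :* p)) :* (v :* v)) ≋-refl Q′ V x P ⟩
      (Q′ + P * (x * P)) * (V * V)            ≈⟨ *-congʳ Q′+PxP≋Q² ⟩
      (Q * Q) * (V * V)                       ≈⟨ solve 2 (λ q v → (q :* q) :* (v :* v) := (q :* v) :* (q :* v))
                                                   ≋-refl Q V ⟩
      (Q * V) * (Q * V)                       ≈⟨ ≋-trans (*-cong QV≋1 QV≋1) (*-identityˡ 1#) ⟩
      1#                                      ≈⟨ GU≋1 ⟨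
      G * U                                   ≈⟨ *-congˡ U′+xG≋U ⟨
      G * (U′ + x * G)                        ≈⟨ solve 3 (λ g u′ y → g :* (u′ :+ y :* g) := g :* u′ :+ y :* (g :* g))
                                                   ≋-refl G U′ x ⟩
      G * U′ + x * (G * G)                    ∎)

    -- `G * U′` is inverted by `G′ * U`, since the four factors pair up as `G * U` and `G′ * U′`.
    denominator-inverse : Q′ * (V * V * (G′ * U)) ≋ 1#
    denominator-inverse = begin
      Q′ * (V * V * (G′ * U))  ≈⟨ *-assoc Q′ (V * V) (G′ * U) ⟨
      Q′ * (V * V) * (G′ * U)  ≈⟨ *-congʳ Q′V²≋GU′ ⟩
      G * U′ * (G′ * U)        ≈⟨ solve 4 (λ g u g′ u′ → g :* u′ :* (g′ :* u) := (g :* u) :* (g′ :* u′))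
                                    ≋-refl G U G′ U′ ⟩
      (G * U) * (G′ * U′)      ≈⟨ *-cong GU≋1 G′U′≋1 ⟩
      1# * 1#                  ≈⟨ *-identityˡ 1# ⟩
      1#                       ∎

    fraction : G′ ≋ P * Q * (V * V * (G′ * U))
    fraction = ≋-sym (begin
      P * Q * (V * V * (G′ * U))          ≈⟨ solve 5 (λ p q v g′ u → p :* q :* (v :* v :* (g′ :* u))
                                               := ((p :* v) :* u) :* ((q :* v) :* g′)) ≋-refl P Q V G′ U ⟩
      ((P * V) * U) * ((Q * V) * G′)      ≈⟨ *-cong (*-congʳ (≋-sym G≋PV)) (*-congʳ QV≋1) ⟩
      (G * U) * (1# * G′)                 ≈⟨ *-cong GU≋1 (*-identityˡ G′) ⟩
      1# * G′                             ≈⟨ *-identityˡ G′ ⟩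
      G′                                  ∎)

-- Counting forests

-- Composing the two enumerations gives a bijection between finite ordinals. This makes counts
-- independent of the bound that `finite-forest` carries.
Finite-unique : ∀ {X : Set} (h h′ : Finite X) → proj₁ h ≡ proj₁ h′
Finite-unique (_ , f) (_ , g) = ↔⇒≡ (g ↔-∘ ↔-sym f)

ι : ℕ → ℚ
ι n = + n ℚ./ 1

-- Forming a rational normalises by a gcd, so the homomorphism laws for `ι` are checked on
-- unnormalised fractions, where the denominators are 1.
toℚᵘ-ι : ∀ n → ℚ.toℚᵘ (ι n) ℚᵘ.≃ (+ n ℚᵘ./ 1)
toℚᵘ-ι n = ℚ.toℚᵘ-fromℚᵘ (+ n ℚᵘ./ 1)

ι-+ : ∀ a b → ι (a ℕ.+ b) ≡ ι a ℚ.+ ι b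
ι-+ a b = ℚ.toℚᵘ-injective (ℚᵘ.≃-trans (toℚᵘ-ι (a ℕ.+ b)) (ℚᵘ.≃-trans
  (ℚᵘ.*≡* (cong (ℤ._* + 1) (sym (cong₂ ℤ._+_ (ℤ.*-identityʳ (+ a)) (ℤ.*-identityʳ (+ b))))))
  (ℚᵘ.≃-sym (ℚᵘ.≃-trans (ℚ.toℚᵘ-homo-+ (ι a) (ι b)) (ℚᵘ.+-cong (toℚᵘ-ι a) (toℚᵘ-ι b))))))

ι-* : ∀ a b → ι (a ℕ.* b) ≡ ι a ℚ.* ι b
ι-* a b = ℚ.toℚᵘ-injective (ℚᵘ.≃-trans (toℚᵘ-ι (a ℕ.* b)) (ℚᵘ.≃-trans
  (ℚᵘ.*≡* (cong (ℤ._* + 1) (ℤ.pos-* a b)))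
  (ℚᵘ.≃-sym (ℚᵘ.≃-trans (ℚ.toℚᵘ-homo-* (ι a) (ι b)) (ℚᵘ.*-cong (toℚᵘ-ι a) (toℚᵘ-ι b))))))

card-Σ : ∀ {m} {P : Fin m → Set} (h : ∀ j → Finite (P j)) → proj₁ (finite-Σ h) ≡ sum (λ j → proj₁ (h j))
card-Σ {zero}  h = refl
card-Σ {suc m} h = cong (proj₁ (h zero) ℕ.+_) (card-Σ (λ j → h (suc j)))

-- `finite-Split` peels off the case k = 0 exactly as `sumUpTo` does, so counts that factor over k
-- and l add up to a Cauchy product.
card-Split : ∀ n {P : ℕ → ℕ → Set} (h : ∀ k l → k ℕ.+ l ≡ n → Finite (P k l)) (f g : ℕ → ℕ) →
             (∀ k l eq → proj₁ (h k l eq) ≡ f k ℕ.* g l) →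
             ι (proj₁ (finite-Split n h)) ≡ ((λ k → ι (f k)) ⊛ (λ l → ι (g l))) n
card-Split zero    h f g h≡ = trans (cong ι (h≡ 0 0 refl)) (ι-* (f 0) (g 0))
card-Split (suc n) h f g h≡ = trans
  (ι-+ (proj₁ (h 0 (suc n) refl)) _)
  (cong₂ ℚ._+_ (trans (cong ι (h≡ 0 (suc n) refl)) (ι-* (f 0) (g (suc n))))
    (card-Split n _ (λ k → f (suc k)) g (λ k l eq → h≡ (suc k) l (cong suc eq))))

module _ {m : ℕ} (B : ColoringMatrix m) where

  forests : Fin m → ℕ → ℕ
  forests i n = proj₁ (finite-forest B (suc n) n ℕ.≤-refl i)

  -- The coefficient of S_i: the factor from `finite-≡` is 1 or 0 as color `j` is allowed below `i`
  -- or not. The index `k` omits the root of the child, which accounts for the factor `x` in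
  -- `forestSeries-unfold`.
  childTrees : Fin m → ℕ → ℕ
  childTrees i k = sum (λ j → proj₁ (finite-≡ (B i j) 1F) ℕ.* forests j k)

  forestSeries childSeries : Fin m → Series
  forestSeries i n = ι (forests i n)
  childSeries  i n = ι (childTrees i n)

  card-First : ∀ i k l N (k<N : k ℕ.< N) (l<N : l ℕ.< N) →
    proj₁ (finite-Σ (λ j → finite-× (finite-≡ (B i j) 1F)
      (finite-× (finite-forest B N k k<N j) (finite-forest B N l l<N i))))
      ≡ childTrees i k ℕ.* forests i l
  card-First i k l N k<N l<N = begin
    proj₁ (finite-Σ (λ j → finite-× (finite-≡ (B i j) 1F)
      (finite-× (finite-forest B N k k<N j) (finite-forest B N l l<N i))))
      ≡⟨ card-Σ (λ j → finite-× (finite-≡ (B i j) 1F)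
           (finite-× (finite-forest B N k k<N j) (finite-forest B N l l<N i))) ⟩
    sum (λ j → w j ℕ.* (proj₁ (finite-forest B N k k<N j) ℕ.* proj₁ (finite-forest B N l l<N i)))
      -- The common bound `N` is replaced by the bounds `suc k` and `suc l` used in `forests`.
      ≡⟨ sum-cong-≗ (λ j → trans
           (cong (w j ℕ.*_) (cong₂ ℕ._*_
             (Finite-unique (finite-forest B N k k<N j) (finite-forest B (suc k) k ℕ.≤-refl j))
             (Finite-unique (finite-forest B N l l<N i) (finite-forest B (suc l) l ℕ.≤-refl i))))
           (sym (ℕ.*-assoc (w j) (forests j k) (forests i l)))) ⟩
    sum (λ j → w j ℕ.* forests j k ℕ.* forests i l)
      ≡⟨ *-distribʳ-sum (forests i l) (λ j → w j ℕ.* forests j k) ⟨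
    childTrees i k ℕ.* forests i l ∎
    where
    open ≡-Reasoning
    w : Fin m → ℕ
    w j = proj₁ (finite-≡ (B i j) 1F)

  forestSeries-unfold : ∀ i → forestSeries i ≈ 1ˢ +ˢ x ⊛ (childSeries i ⊛ forestSeries i)
  forestSeries-unfold i zero    = sym (trans (cong (1ℚ ℚ.+_) (x⊛-zero (childSeries i ⊛ forestSeries i))) (ℚ.+-identityʳ 1ℚ))
  forestSeries-unfold i (suc n) = trans
    -- `transport` keeps the cardinality, so `forests i (suc n)` computes to that of a
    -- `finite-Split` with bound `suc n`.
    (card-Split n _ (childTrees i) (forests i) (λ k l _ → card-First i k l (suc n) _ _))
    (sym (trans (ℚ.+-identityˡ _) (x⊛-suc (childSeries i ⊛ forestSeries i) n)))

  generatingFunction-t : ∀ i → generatingFunction (t B i) ≈ x ⊛ forestSeries i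
  generatingFunction-t i zero    = sym (x⊛-zero (forestSeries i))
  generatingFunction-t i (suc n) = sym (x⊛-suc (forestSeries i) n)

-- The strictly lower triangular matrix

below : ∀ {m} → Fin m → Fin m → ℕ
below i j = proj₁ (finite-≡ {2} (if does (j <? i) then 1F else 0F) 1F)

sum-zero : ∀ {m} (f : Fin m → ℕ) → sum (λ j → 0 ℕ.* f j) ≡ 0
sum-zero {zero}  f = refl
sum-zero {suc m} f = sum-zero (λ j → f (suc j))

-- Passing from `inject₁ i` to `suc i` admits one more color, `inject₁ i` itself. The induction
-- works because `below` is unchanged by computation when both indices are shifted.
sum-below-suc : ∀ {m} (i : Fin m) (f : Fin (suc m) → ℕ) →
  sum (λ j → below (suc i) j ℕ.* f j) ≡ sum (λ j → below (inject₁ i) j ℕ.* f j) ℕ.+ f (inject₁ i)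
sum-below-suc {suc m} zero f = begin
  1 ℕ.* f zero ℕ.+ sum (λ j → 0 ℕ.* f (suc j))
    ≡⟨ cong₂ ℕ._+_ (ℕ.*-identityˡ (f zero)) (sum-zero (λ j → f (suc j))) ⟩
  f zero ℕ.+ 0
    ≡⟨ ℕ.+-comm (f zero) 0 ⟩
  f zero
    ≡⟨ cong (ℕ._+ f zero) (sum-zero f) ⟨
  sum (λ j → 0 ℕ.* f j) ℕ.+ f zero ∎
  where open ≡-Reasoning
sum-below-suc {suc m} (suc i) f = trans
  (cong (1 ℕ.* f zero ℕ.+_) (sum-below-suc i (λ j → f (suc j))))
  (sym (ℕ.+-assoc (1 ℕ.* f zero) _ _))

-- Fractions for the colors of a fixed matrix

module _ (m : ℕ) where

  private
    G S : Fin (suc m) → Series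
    G = forestSeries (A (suc m))
    S = childSeries (A (suc m))

  S-zero : S zero ≈ 0ˢ
  S-zero n = cong ι (sum-zero (λ j → forests (A (suc m)) j n))

  S-suc : ∀ i → S (suc i) ≈ S (inject₁ i) +ˢ G (inject₁ i)
  S-suc i n = trans (cong ι (sum-below-suc i (λ j → forests (A (suc m)) j n)))
                    (ι-+ (childTrees (A (suc m)) (inject₁ i) n) _)

  -- G = p / (x q) for the (k+1)-st polynomials, where P is the series p / x.
  record Fraction (k : ℕ) (G : Series) : Set where
    field
      P Q⁻¹     : Series
      p≈xP      : ⟦ p (suc k) ⟧ ≈ x ⊛ P
      q-inverse : ⟦ q (suc k) ⟧ ⊛ Q⁻¹ ≈ 1ˢ
      G≈PQ⁻¹    : G ≈ P ⊛ Q⁻¹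

  -- The first color admits no children, so only the empty forest is counted and the series is 1.
  fraction-zero : Fraction 0 (G zero)
  fraction-zero = record
    { P         = 1ˢ
    ; Q⁻¹       = 1ˢ
    ; p≈xP      = ≈-sym (S.*-identityʳ x)
    ; q-inverse = ≈-trans (S.*-identityʳ _) ⟦1⟧
    ; G≈PQ⁻¹    = begin
        G zero                           ≈⟨ forestSeries-unfold (A (suc m)) zero ⟩
        1ˢ +ˢ x ⊛ (S zero ⊛ G zero)      ≈⟨ S.+-congˡ {1ˢ} (S.*-congˡ {x} (S.*-congʳ {G zero} S-zero)) ⟩
        1ˢ +ˢ x ⊛ (0ˢ ⊛ G zero)          ≈⟨ S.+-congˡ {1ˢ} (S.*-congˡ {x} (S.zeroˡ (G zero))) ⟩
        1ˢ +ˢ x ⊛ 0ˢ                     ≈⟨ S.+-congˡ {1ˢ} (S.zeroʳ x) ⟩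
        1ˢ +ˢ 0ˢ                         ≈⟨ S.+-identityʳ 1ˢ ⟩
        1ˢ                               ≈⟨ S.*-identityʳ 1ˢ ⟨
        1ˢ ⊛ 1ˢ                          ∎
    }
    where open SetoidReasoning ≈-setoid

  fraction-suc : ∀ {k} i → Fraction k (G (inject₁ i)) → Fraction (suc k) (G (suc i))
  fraction-suc {k} i fr = record
    -- The next `p` is `p (suc k) ⊗ q (suc k)`, and x divides its first factor.
    { P         = P ⊛ ⟦ q (suc k) ⟧
    ; Q⁻¹       = Q⁻¹ ⊛ Q⁻¹ ⊛ (G (suc i) ⊛ U)
    ; p≈xP      = ≈-trans (⟦⊗⟧ (p (suc k)) (q (suc k)))
                    (≈-trans (S.*-congʳ {⟦ q (suc k) ⟧} p≈xP) (S.*-assoc x P ⟦ q (suc k) ⟧))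
    ; q-inverse = denominator-inverse
    ; G≈PQ⁻¹    = fraction
    }
    where
    open Fraction fr
    open Step seriesRing
    open SetoidReasoning ≈-setoid
    U U′ : Series
    U  = 1ˢ +ˢ -ˢ (x ⊛ S (inject₁ i))
    U′ = 1ˢ +ˢ -ˢ (x ⊛ S (suc i))
    GU≈1 : G (inject₁ i) ⊛ U ≈ 1ˢ
    GU≈1 = unfold⇒inverse x _ (S (inject₁ i)) (forestSeries-unfold (A (suc m)) (inject₁ i))
    G′U′≈1 : G (suc i) ⊛ U′ ≈ 1ˢ
    G′U′≈1 = unfold⇒inverse x _ (S (suc i)) (forestSeries-unfold (A (suc m)) (suc i))
    U′+xG≈U : U′ +ˢ x ⊛ G (inject₁ i) ≈ U
    U′+xG≈U = ≈-trans
      (S.+-congʳ {x ⊛ G (inject₁ i)} (S.+-congˡ {1ˢ} (S.-‿cong (S.*-congˡ {x} (S-suc i)))))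
      (1-x[S+G]+xG x (S (inject₁ i)) (G (inject₁ i)))
    q-suc : ⟦ q (suc (suc k)) ⟧ +ˢ P ⊛ (x ⊛ P) ≈ ⟦ q (suc k) ⟧ ⊛ ⟦ q (suc k) ⟧
    q-suc = begin
      ⟦ q (suc (suc k)) ⟧ +ˢ P ⊛ (x ⊛ P)
        ≈⟨ S.+-cong (⟦⊖⟧ (q (suc k) ⊗ q (suc k)) _) (≈-sym (⟦²/x⟧ (p (suc k)) P p≈xP)) ⟩
      ⟦ q (suc k) ⊗ q (suc k) ⟧ +ˢ -ˢ ⟦ (p (suc k) ⊗ p (suc k)) /x ⟧ +ˢ ⟦ (p (suc k) ⊗ p (suc k)) /x ⟧
        ≈⟨ S.+-assoc ⟦ q (suc k) ⊗ q (suc k) ⟧ _ _ ⟩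
      ⟦ q (suc k) ⊗ q (suc k) ⟧ +ˢ (-ˢ ⟦ (p (suc k) ⊗ p (suc k)) /x ⟧ +ˢ ⟦ (p (suc k) ⊗ p (suc k)) /x ⟧)
        ≈⟨ S.+-congˡ {⟦ q (suc k) ⊗ q (suc k) ⟧} (S.-‿inverseˡ ⟦ (p (suc k) ⊗ p (suc k)) /x ⟧) ⟩
      ⟦ q (suc k) ⊗ q (suc k) ⟧ +ˢ 0ˢ
        ≈⟨ S.+-identityʳ _ ⟩
      ⟦ q (suc k) ⊗ q (suc k) ⟧
        ≈⟨ ⟦⊗⟧ (q (suc k)) (q (suc k)) ⟩
      ⟦ q (suc k) ⟧ ⊛ ⟦ q (suc k) ⟧ ∎
    open Recursion x (G (inject₁ i)) (G (suc i)) U U′ P ⟦ q (suc k) ⟧ ⟦ q (suc (suc k)) ⟧ Q⁻¹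
           GU≈1 G′U′≈1 U′+xG≈U q-inverse G≈PQ⁻¹ q-suc

  -- The matrix stays `A (suc m)` while the color varies, so different matrices are never compared;
  -- the theorem is the case of the last color.
  forestSeries-fraction : ∀ i → Fraction (toℕ i) (G i)
  forestSeries-fraction = <-weakInduction (λ i → Fraction (toℕ i) (G i)) fraction-zero
    (λ i fr → fraction-suc i (subst (λ k → Fraction k (G (inject₁ i))) (toℕ-inject₁ i) fr))

  F≈p÷q : F (suc m) ≈ p (suc m) ÷ q (suc m)
  F≈p÷q = Q⁻¹ , q-inverse , (begin
    F (suc m)              ≈⟨ generatingFunction-t (A (suc m)) (fromℕ m) ⟩
    x ⊛ G (fromℕ m)        ≈⟨ S.*-congˡ {x} G≈PQ⁻¹ ⟩
    x ⊛ (P ⊛ Q⁻¹)          ≈⟨ S.*-assoc x P Q⁻¹ ⟨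
    x ⊛ P ⊛ Q⁻¹            ≈⟨ S.*-congʳ {Q⁻¹} p≈xP ⟨
    ⟦ p (suc m) ⟧ ⊛ Q⁻¹    ∎)
    where
    open Fraction (subst (λ k → Fraction k (G (fromℕ m))) (toℕ-fromℕ m) (forestSeries-fraction (fromℕ m)))
    open SetoidReasoning ≈-setoid

theorem40 : (m : ℕ) .{{_ : NonZero m}} → Rational (F m) × F m ≈ p m ÷ q m
theorem40 (suc m) = (p (suc m) , q (suc m) , F≈p÷q m) , F≈p÷q m
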